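{- Let $\Omega$ be a $D$-set, possibly augmented with unary predicates. Let $s=(a_i)_{i\in I}$ be an unbounded indiscernible sequence of single elements of $\Omega$, and let $B\subseteq\Omega$. Then $s$ is weakly indiscernible over $B$ if and only if $B\cap H(s)=\emptyset$.
   Context: A $D$-set is a set $\Omega$ with a quaternary relation $D$, written $D(wx;yz)$ or $wx|yz$, satisfying for all $w,x,y,z$: (D1) $D(wx;yz)\to (D(xw;yz)\wedge D(yz;wx))$; (D2) $D(wx;yz)\to\neg D(wy;xz)$; (D3) $D(wx;yz)\to\forall v\,(D(vx;yz)\vee D(wx;yv))$; (D4) $(w\neq y\wedge x\neq y)\to D(wx;yy)$. A splitting of $\Omega$ is a partition into at least two parts (sectors) such that (i) if $a,b$ lie in a part $\Sigma$ and $c,d\notin\Sigma$ then $D(ab;cd)$, (ii) if $a,b,c,d$ lie in four distinct parts then $\neg D(ab;cd)$; a node splitting has more than two sectors. Every splitting of a subset $A$ (with induced relation) with more than two parts extends uniquely to a node splitting of $\Omega$ whose sectors meet $A$ in the parts. A sequence is indexed by a linear order $I$; it is unbounded if $I$ has no least and no greatest element; indiscernible means order-indiscernible over $\emptyset$ in the full language. An indiscernible sequence $s=(a_i)$ of single elements is constant, or petaled (elements pairwise distinct and no $D(a_ia_j;a_ka_\ell)$ holds with $i,j,k,\ell$ pairwise distinct), or monotonic (elements pairwise distinct and $a_ia_j|a_ka_\ell$ for all $i<j<k<\ell$). The discernible hull $H(s)$ is: $\emptyset$ if $s$ is constant; if $s$ is petaled, the union of the sectors containing elements of $s$ of the node splitting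 of $\Omega$ extending $\{\{a_i\}:i\in I\}$; if $s$ is monotonic, the union of $s$ with $H_1(s)=\{x:\exists i<j<k,\ a_ia_k|a_jx\}$, $H_2(s)=\{x:\exists i<j<k$ such that no $D$-relation holds on $\{a_i,a_j,a_k,x\}\}$ (no $D(pq;rt)$ with $p,q,r,t$ pairwise distinct elements of this set), and $H_3(s)=\{x:\exists i<j<k<\ell,\ a_ix|a_ka_\ell\text{ and }a_ia_j|xa_\ell\}$. $s$ is weakly indiscernible over $B$ if for every atomic formula $D(t_1t_2;t_3t_4)$ whose terms are variables or parameters from $B$, its truth value on elements of $s$ depends only on the order type of the indices used. -}

module Defs where

open import Level using (_⊔_; Lift; 0ℓ) renaming (suc to lsuc)
open import Data.Nat using (ℕ; suc)
open import Data.Fin as Fin using (Fin)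
open import Data.Product using (Σ; ∃; _×_; _,_)
open import Data.Sum using (_⊎_; inj₁; inj₂)
open import Data.Empty using (⊥)
open import Relation.Nullary using (¬_)
open import Relation.Binary.PropositionalEquality using (_≡_; _≢_)
open import Relation.Binary.Structures using (IsStrictTotalOrder)
open import Data.Vec.Functional using (_∷_)

-- Classical logic (the paper's ambient metatheory): excluded middle.
ExcludedMiddle : Set₁
ExcludedMiddle = (A : Set) → A ⊎ ¬ A

_⇔_ : ∀ {ℓ ℓ'} → Set ℓ → Set ℓ' → Set (ℓ ⊔ ℓ')
A ⇔ B = (A → B) × (B → A)

-- D-sets: D w x y z  stands for  D(wx;yz), i.e. wx|yz
record DSet : Set₁ where
  field
    Ω  : Set
    D  : Ω → Ω → Ω → Ω → Set
    D1 : ∀ {w x y z} → D w x y z → D x w y z × D y z w x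
    D2 : ∀ {w x y z} → D w x y z → ¬ D w y x z
    D3 : ∀ {w x y z} → D w x y z → ∀ v → D v x y z ⊎ D w x y v
    D4 : ∀ {w x y} → w ≢ y → x ≢ y → D w x y y

record LinOrd : Set₁ where
  field
    I    : Set
    _<_  : I → I → Set
    isSTO : IsStrictTotalOrder _≡_ _<_

Unbounded : LinOrd → Set
Unbounded L = ∀ i → (∃ λ j → j < i) × (∃ λ j → i < j)
  where open LinOrd L

module _ (𝔇 : DSet) where
  open DSet 𝔇

  -- A partition of Ω is given by its "same sector" equivalence relation E.
  record Splitting : Set₁ where
    field
      E      : Ω → Ω → Set
      E-refl : ∀ {a} → E a a
      E-sym  : ∀ {a b} → E a b → E b a
      E-trans : ∀ {a b c} → E a b → E b c → E a c
      two-parts : ∃ λ a → ∃ λ b → ¬ E a b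
      split-i  : ∀ {a b c d} → E a b → ¬ E a c → ¬ E a d → D a b c d
      split-ii : ∀ {a b c d} → ¬ E a b → ¬ E a c → ¬ E a d → ¬ E b c → ¬ E b d → ¬ E c d
                 → ¬ D a b c d

  IsNode : Splitting → Set
  IsNode S = ∃ λ a → ∃ λ b → ∃ λ c → ¬ E a b × ¬ E a c × ¬ E b c
    where open Splitting S

  module Lang (U : Set) (P : U → Ω → Set) where
    data Formula (n : ℕ) : Set where
      dR  : Fin n → Fin n → Fin n → Fin n → Formula n
      eqR : Fin n → Fin n → Formula n
      pR  : U → Fin n → Formula n
      neg : Formula n → Formula n
      and : Formula n → Formula n → Formula n
      ex  : Formula (suc n) → Formula n

    Sat : ∀ {n} → (Fin n → Ω) → Formula n → Set
    Sat ρ (dR x y z w) = D (ρ x) (ρ y) (ρ z) (ρ w)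
    Sat ρ (eqR x y)    = ρ x ≡ ρ y
    Sat ρ (pR u x)     = P u (ρ x)
    Sat ρ (neg φ)      = ¬ Sat ρ φ
    Sat ρ (and φ ψ)    = Sat ρ φ × Sat ρ ψ
    Sat ρ (ex φ)       = Σ Ω λ x → Sat (x ∷ ρ) φ

    module Seq (L : LinOrd) (a : LinOrd.I L → Ω) where
      open LinOrd L

      Increasing : ∀ {n} → (Fin n → I) → Set
      Increasing ι = ∀ k l → k Fin.< l → ι k < ι l

      Indiscernible : Set
      Indiscernible = ∀ n (φ : Formula n) (ι κ : Fin n → I) → Increasing ι → Increasing κ
                      → Sat (λ k → a (ι k)) φ ⇔ Sat (λ k → a (κ k)) φ

      Constant : Set
      Constant = ∀ i j → a i ≡ a j

      Injective : Set
      Injective = ∀ i j → a i ≡ a j → i ≡ j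

      Petaled : Set
      Petaled = Injective × (∀ i j k l → i ≢ j → i ≢ k → i ≢ l → j ≢ k → j ≢ l → k ≢ l
                                   → ¬ D (a i) (a j) (a k) (a l))

      Monotonic : Set
      Monotonic = Injective × (∀ i j k l → i < j → j < k → k < l → D (a i) (a j) (a k) (a l))

      -- x lies in H(s) in the petaled case: x is in the sector of some a_i of the node splitting
      -- of Ω extending {{a_i} : i ∈ I} (sectors meet the range of s exactly in the singletons)
      InHPetal : Ω → Set₁
      InHPetal x = ∃ λ (S : Splitting) → IsNode S ×
                   (∀ i j → Splitting.E S (a i) (a j) ⇔ (a i ≡ a j)) ×
                   (∃ λ i → Splitting.E S x (a i))

      InH1 : Ω → Set
      InH1 x = ∃ λ i → ∃ λ j → ∃ λ k → i < j × j < k × D (a i) (a k) (a j) x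

      In4 : I → I → I → Ω → Ω → Set
      In4 i j k x p = p ≡ a i ⊎ p ≡ a j ⊎ p ≡ a k ⊎ p ≡ x

      InH2 : Ω → Set
      InH2 x = ∃ λ i → ∃ λ j → ∃ λ k → i < j × j < k ×
               (∀ p q r t → In4 i j k x p → In4 i j k x q → In4 i j k x r → In4 i j k x t →
                p ≢ q → p ≢ r → p ≢ t → q ≢ r → q ≢ t → r ≢ t → ¬ D p q r t)

      InH3 : Ω → Set
      InH3 x = ∃ λ i → ∃ λ j → ∃ λ k → ∃ λ l → i < j × j < k × k < l ×
               D (a i) x (a k) (a l) × D (a i) (a j) x (a l)

      InRange : Ω → Set
      InRange x = ∃ λ i → x ≡ a i

      -- the discernible hull H(s) (empty when s is constant)
      InH : Ω → Set₁
      InH x = (Petaled × InHPetal x)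
            ⊎ Lift (lsuc 0ℓ) (Monotonic × (InRange x ⊎ InH1 x ⊎ InH2 x ⊎ InH3 x))

      Term : ℕ → (Ω → Set) → Set
      Term n B = Fin n ⊎ Σ Ω B

      evalT : ∀ {n} {B : Ω → Set} → (Fin n → I) → Term n B → Ω
      evalT ι (inj₁ k)       = a (ι k)
      evalT ι (inj₂ (b , _)) = b

      SameOrderType : ∀ {n} → (Fin n → I) → (Fin n → I) → Set
      SameOrderType ι κ = ∀ k l → (ι k < ι l) ⇔ (κ k < κ l)

      WeaklyIndiscernibleOver : (Ω → Set) → Set
      WeaklyIndiscernibleOver B =
        ∀ n (t₁ t₂ t₃ t₄ : Term n B) (ι κ : Fin n → I) → SameOrderType ι κ →
        D (evalT ι t₁) (evalT ι t₂) (evalT ι t₃) (evalT ι t₄)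
          ⇔ D (evalT κ t₁) (evalT κ t₂) (evalT κ t₃) (evalT κ t₄)

{-# OPTIONS --safe #-}

-- An indiscernible sequence is constant, petaled or monotonic: each of the other two ways in
-- which four elements in order could be related contradicts D3 on five elements.
--
-- If s is petaled, the node splitting extending the singletons is "x ~ y iff xy|a_j a_k for some
-- j ≠ k".  A parameter outside H(s) is then in the sector of no a_i, and the axioms of a splitting
-- leave no way for a D-relation to distinguish the a_i.
--
-- If s is monotonic, a parameter outside H(s) is attached at one of the two ends of s: excluding
-- H₁ and H₂, every triple places it at one of the ends, and excluding H₃ these ends agree.  The
-- D-relations between s and parameters sitting at ±∞ are read off from the order.
--
-- Conversely, moving the indices in the relations witnessing x ∈ H(s) contradicts D2 in each case.
module Submission where

open import Defs
open import Data.Empty using (⊥-elim)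
open import Data.Fin as Fin using (Fin; zero; suc)
import Data.Fin.Properties as Fin
open import Data.Nat using (ℕ; s≤s⁻¹; z<s)
open import Data.Product using (∃; _×_; _,_; proj₁; proj₂)
open import Data.Sum as Sum using (_⊎_; inj₁; inj₂; map₂; fromInj₁; fromInj₂)
open import Data.Vec.Functional using (Vector; []; _∷_; head)
open import Function using (_∘_)
open import Level using (lift)
import Relation.Binary.Construct.Flip.EqAndOrd as Flip
open import Relation.Binary.Definitions using (tri<; tri≈; tri>)
open import Relation.Binary.PropositionalEquality using (_≡_; _≢_; refl; sym; cong; subst; ≢-sym)
open import Relation.Binary.Structures using (IsStrictTotalOrder)
open import Relation.Nullary using (¬_)

module _ {A B : Set} where

  drop-head : ¬ A → A ⊎ B → B
  drop-head ¬a = fromInj₂ (⊥-elim ∘ ¬a)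

  drop-last : ¬ B → A ⊎ B → A
  drop-last ¬b = fromInj₁ (⊥-elim ∘ ¬b)

-- Consequences of the D-set axioms

module DSetProperties (𝔇 : DSet) where
  open DSet 𝔇

  swapˡ : ∀ {w x y z} → D w x y z → D x w y z
  swapˡ d = proj₁ (D1 d)

  swap : ∀ {w x y z} → D w x y z → D y z w x
  swap d = proj₂ (D1 d)

  swapʳ : ∀ {w x y z} → D w x y z → D w x z y
  swapʳ = swap ∘ swapˡ ∘ swap

  -- Complements `D2`: together they make the three pairings of four points mutually exclusive.
  exclude : ∀ {w x y z} → D w x y z → ¬ D w z x y
  exclude = D2 ∘ swapʳ

  -- For x = y, the relation that `D2` forbids is the given one.
  disjoint₂₃ : ∀ {w x y z} → D w x y z → x ≢ y
  disjoint₂₃ d refl = D2 d d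

  disjoint₁₃ : ∀ {w x y z} → D w x y z → w ≢ y
  disjoint₁₃ = disjoint₂₃ ∘ swapˡ

  disjoint₂₄ : ∀ {w x y z} → D w x y z → x ≢ z
  disjoint₂₄ = disjoint₂₃ ∘ swapʳ

  disjoint₁₄ : ∀ {w x y z} → D w x y z → w ≢ z
  disjoint₁₄ = disjoint₁₃ ∘ swapʳ

  D-≡ˡ : ∀ {w x y z} → w ≡ x → w ≢ y → w ≢ z → D w x y z
  D-≡ˡ refl w≢y w≢z = swap (D4 (≢-sym w≢y) (≢-sym w≢z))

  D-≡ʳ : ∀ {w x y z} → y ≡ z → w ≢ y → x ≢ y → D w x y z
  D-≡ʳ refl = D4

  D-resp-≡ : ∀ {w x y z w′ x′ y′ z′} → w ≡ w′ → x ≡ x′ → y ≡ y′ → z ≡ z′ → D w x y z → D w′ x′ y′ z′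
  D-resp-≡ refl refl refl refl d = d

  replace₂₄ : ∀ {w x y z} → D w x y z → ∀ v → D w v y z ⊎ D w x y v
  replace₂₄ d v = Sum.map swapˡ swapˡ (D3 (swapˡ d) v)

  replace₂₃ : ∀ {w x y z} → D w x y z → ∀ v → D w v y z ⊎ D w x v z
  replace₂₃ d v = Sum.map swapʳ swapʳ (replace₂₄ (swapʳ d) v)

  -- If `D3` yields the claim from neither hypothesis, it yields xy|uz and yz|ux, two different
  -- pairings of the same points.
  D-trans : ∀ {x y z u v} → D x y u v → D y z u v → D x z u v
  D-trans {x} {y} {z} d e with replace₂₄ d z | D3 e x
  ... | inj₁ f | _      = f
  ... | inj₂ f | inj₁ g = g
  ... | inj₂ f | inj₂ g = ⊥-elim (exclude (swapˡ f) (swapʳ g))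

  private
    choose₂ : ∀ {p q r t u v} → r ≡ u ⊎ r ≡ v → t ≡ u ⊎ t ≡ v → r ≢ t → D p q r t → D p q u v
    choose₂ (inj₁ refl) (inj₁ refl) r≢t d = ⊥-elim (r≢t refl)
    choose₂ (inj₁ refl) (inj₂ refl) r≢t d = d
    choose₂ (inj₂ refl) (inj₁ refl) r≢t d = swapʳ d
    choose₂ (inj₂ refl) (inj₂ refl) r≢t d = ⊥-elim (r≢t refl)

    choose₃ : ∀ {p q r t u v w} → q ≡ u ⊎ q ≡ v ⊎ q ≡ w → r ≡ u ⊎ r ≡ v ⊎ r ≡ w →
              t ≡ u ⊎ t ≡ v ⊎ t ≡ w → q ≢ r → q ≢ t → r ≢ t →
              D p q r t → D p u v w ⊎ D p v u w ⊎ D p w u v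
    choose₃ (inj₁ refl) r t q≢r q≢t r≢t d =
      inj₁ (choose₂ (drop-head (q≢r ∘ sym) r) (drop-head (q≢t ∘ sym) t) r≢t d)
    choose₃ (inj₂ (inj₁ refl)) r t q≢r q≢t r≢t d =
      inj₂ (inj₁ (choose₂ (map₂ (drop-head (q≢r ∘ sym)) r) (map₂ (drop-head (q≢t ∘ sym)) t) r≢t d))
    choose₃ (inj₂ (inj₂ refl)) r t q≢r q≢t r≢t d =
      inj₂ (inj₂ (choose₂ (map₂ (drop-last (q≢r ∘ sym)) r) (map₂ (drop-last (q≢t ∘ sym)) t) r≢t d))

  -- `InH2` ranges over all enumerations of a four-element set. By `D1` only the partner of `s`
  -- matters, so three relations represent them all.
  distinct-in-quadruple : ∀ {p q r t s u v w} →
    p ≡ s ⊎ p ≡ u ⊎ p ≡ v ⊎ p ≡ w → q ≡ s ⊎ q ≡ u ⊎ q ≡ v ⊎ q ≡ w →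
    r ≡ s ⊎ r ≡ u ⊎ r ≡ v ⊎ r ≡ w → t ≡ s ⊎ t ≡ u ⊎ t ≡ v ⊎ t ≡ w →
    p ≢ q → p ≢ r → p ≢ t → q ≢ r → q ≢ t → r ≢ t →
    D p q r t → D s u v w ⊎ D s v u w ⊎ D s w u v
  distinct-in-quadruple (inj₁ refl) q r t p≢q p≢r p≢t q≢r q≢t r≢t =
    choose₃ (drop-head (p≢q ∘ sym) q) (drop-head (p≢r ∘ sym) r) (drop-head (p≢t ∘ sym) t) q≢r q≢t r≢t
  distinct-in-quadruple (inj₂ (inj₁ refl)) q r t p≢q p≢r p≢t q≢r q≢t r≢t d
    with choose₃ (map₂ (drop-head (p≢q ∘ sym)) q) (map₂ (drop-head (p≢r ∘ sym)) r)
                 (map₂ (drop-head (p≢t ∘ sym)) t) q≢r q≢t r≢t d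
  ... | inj₁ e        = inj₁ (swapˡ e)
  ... | inj₂ (inj₁ e) = inj₂ (inj₂ (swap e))
  ... | inj₂ (inj₂ e) = inj₂ (inj₁ (swap e))
  distinct-in-quadruple (inj₂ (inj₂ (inj₁ refl))) q r t p≢q p≢r p≢t q≢r q≢t r≢t d
    with choose₃ (map₂ (map₂ (drop-head (p≢q ∘ sym))) q) (map₂ (map₂ (drop-head (p≢r ∘ sym))) r)
                 (map₂ (map₂ (drop-head (p≢t ∘ sym))) t) q≢r q≢t r≢t d
  ... | inj₁ e        = inj₂ (inj₁ (swapˡ e))
  ... | inj₂ (inj₁ e) = inj₂ (inj₂ (swapʳ (swap e)))
  ... | inj₂ (inj₂ e) = inj₁ (swap e)
  distinct-in-quadruple (inj₂ (inj₂ (inj₂ refl))) q r t p≢q p≢r p≢t q≢r q≢t r≢t d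
    with choose₃ (map₂ (map₂ (drop-last (p≢q ∘ sym))) q) (map₂ (map₂ (drop-last (p≢r ∘ sym))) r)
                 (map₂ (map₂ (drop-last (p≢t ∘ sym))) t) q≢r q≢t r≢t d
  ... | inj₁ e        = inj₂ (inj₂ (swapˡ e))
  ... | inj₂ (inj₁ e) = inj₂ (inj₁ (swapʳ (swap e)))
  ... | inj₂ (inj₂ e) = inj₁ (swapʳ (swap e))

-- Points at an end of a sequence

-- Applied to _<_ and to its converse, so "lower" stands for either end of the sequence.
module LowerEnd (𝔇 : DSet) {I : Set} {_<_ : I → I → Set} (sto : IsStrictTotalOrder _≡_ _<_)
                (lower : ∀ i → ∃ λ j → j < i) (a : I → DSet.Ω 𝔇) where
  open DSet 𝔇
  open DSetProperties 𝔇
  open IsStrictTotalOrder sto using (compare) renaming (trans to <-trans)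

  -- The point behaves like a further term placed before all others. `j` and `k` are unordered and
  -- may coincide, so uses need no case split on them.
  AtLowerEnd : Ω → Set
  AtLowerEnd x = ∀ i j k → i < j → i < k → D x (a i) (a j) (a k)

  AtLowerEnd-sorted : ∀ {x} → (∀ i → x ≢ a i) → (∀ {i j} → i < j → a i ≢ a j) →
                      (∀ {i j k} → i < j → j < k → D x (a i) (a j) (a k)) → AtLowerEnd x
  AtLowerEnd-sorted x∉s <⇒a≢ sorted i j k i<j i<k with compare j k
  ... | tri< j<k _ _ = sorted i<j j<k
  ... | tri≈ _ refl _ = D4 (x∉s j) (<⇒a≢ i<j)
  ... | tri> _ _ k<j = swapʳ (sorted i<k k<j)

  below₂ : ∀ i j → ∃ λ k → k < i × k < j
  below₂ i j with compare i j
  ... | tri< i<j _ _ = let k , k<i = lower i in k , k<i , <-trans k<i i<j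
  ... | tri≈ _ refl _ = let k , k<i = lower i in k , k<i , k<i
  ... | tri> _ _ j<i = let k , k<j = lower j in k , <-trans k<j j<i , k<j

  -- Otherwise the least index would be `j` or `k`, and `x` would be paired with its term instead.
  end-least : ∀ {x i j k} → AtLowerEnd x → j ≢ k → D x (a i) (a j) (a k) → i < j
  end-least {x} {i} {j} {k} x↓ j≢k d with compare i j
  ... | tri< i<j _ _ = i<j
  ... | tri≈ _ refl _ = ⊥-elim (disjoint₂₃ d refl)
  ... | tri> _ _ j<i with compare j k
  ...   | tri< j<k _ _ = ⊥-elim (D2 d (x↓ j i k j<i j<k))
  ...   | tri≈ _ j≡k _ = ⊥-elim (j≢k j≡k)
  ...   | tri> _ _ k<j = ⊥-elim (exclude d (x↓ k i j (<-trans k<j j<i) k<j))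

  same-end : ∀ {x y} → AtLowerEnd x → AtLowerEnd y → ∀ i j → D x y (a i) (a j)
  same-end x↓ y↓ i j = let k , k<i , k<j = below₂ i j in
    D-trans (x↓ k i j k<i k<j) (swapˡ (y↓ k i j k<i k<j))

  end-transfer : ∀ {x i j k i′ j′ k′} → AtLowerEnd x → (i < j → i′ < j′) → (i < k → i′ < k′) →
                 j ≢ k → D x (a i) (a j) (a k) → D x (a i′) (a j′) (a k′)
  end-transfer x↓ f g j≢k d =
    x↓ _ _ _ (f (end-least x↓ j≢k d)) (g (end-least x↓ (≢-sym j≢k) (swapʳ d)))

module _ (em : ExcludedMiddle) (𝔇 : DSet) (U : Set) (P : U → DSet.Ω 𝔇 → Set)
         (L : LinOrd) (unbounded : Unbounded L) (a : LinOrd.I L → DSet.Ω 𝔇) where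
  open DSet 𝔇
  open DSetProperties 𝔇
  open LinOrd L
  open Lang 𝔇 U P
  open Seq L a
  open IsStrictTotalOrder isSTO using (compare; asym; irrefl) renaming (trans to <-trans)

  private
    lower : ∀ i → ∃ λ j → j < i
    lower = proj₁ ∘ unbounded

    upper : ∀ i → ∃ λ j → i < j
    upper = proj₂ ∘ unbounded

  -- Increasing tuples and sorting of index quadruples

  <⇒≢ : ∀ {i j} → i < j → i ≢ j
  <⇒≢ i<j i≡j = irrefl i≡j i<j

  dec-≡ : (i j : I) → i ≡ j ⊎ i ≢ j
  dec-≡ i j = em (i ≡ j)

  increasing-∷ : ∀ {n i} {ι : Vector I (ℕ.suc n)} → i < head ι → Increasing ι → Increasing (i ∷ ι)
  increasing-∷ i<ι inc zero    (suc zero)    _   = i<ι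
  increasing-∷ i<ι inc zero    (suc (suc l)) _   = <-trans i<ι (inc zero (suc l) z<s)
  increasing-∷ i<ι inc (suc k) (suc l)       k<l = inc k l (s≤s⁻¹ k<l)

  increasing-[] : ∀ {i} → Increasing (i ∷ [])
  increasing-[] zero zero ()

  sameOrderType : ∀ {n} {ι κ : Fin n → I} → Increasing ι → Increasing κ → SameOrderType ι κ
  sameOrderType incι incκ k l = reflect incι incκ , reflect incκ incι
    where
      reflect : ∀ {ι κ} → Increasing ι → Increasing κ → ι k < ι l → κ k < κ l
      reflect incι incκ ι< with Fin.<-cmp k l
      ... | tri< k<l _ _ = incκ k l k<l
      ... | tri≈ _ refl _ = ⊥-elim (irrefl refl ι<)
      ... | tri> _ _ l<k = ⊥-elim (asym ι< (incι l k l<k))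

  module _ (Q : I → I → I → I → Set)
           (Q-swapˡ : ∀ {i j k l} → Q i j k l → Q j i k l)
           (Q-swap : ∀ {i j k l} → Q i j k l → Q k l i j)
           (Q-sorted : ∀ {i j k l} → i < j → k < l → i < k → Q i j k l) where

    private
      sort-minima : ∀ {i j k l} → i < j → k < l → i ≢ k → Q i j k l
      sort-minima {i} {_} {k} i<j k<l i≢k with compare i k
      ... | tri< i<k _ _ = Q-sorted i<j k<l i<k
      ... | tri≈ _ i≡k _ = ⊥-elim (i≢k i≡k)
      ... | tri> _ _ k<i = Q-swap (Q-sorted k<l i<j k<i)

    -- The symmetries sort each pair and put the pair with the smaller minimum first. The position
    -- of `j` relative to `k` and `l` is left to `Q-sorted`.
    wlog-sorted : ∀ {i j k l} → i ≢ j → i ≢ k → i ≢ l → j ≢ k → j ≢ l → k ≢ l → Q i j k l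
    wlog-sorted {i} {j} {k} {l} i≢j i≢k i≢l j≢k j≢l k≢l with compare i j | compare k l
    ... | tri≈ _ i≡j _ | _            = ⊥-elim (i≢j i≡j)
    ... | _            | tri≈ _ k≡l _ = ⊥-elim (k≢l k≡l)
    ... | tri< i<j _ _ | tri< k<l _ _ = sort-minima i<j k<l i≢k
    ... | tri> _ _ j<i | tri< k<l _ _ = Q-swapˡ (sort-minima j<i k<l j≢k)
    ... | tri< i<j _ _ | tri> _ _ l<k = Q-swap (Q-swapˡ (sort-minima l<k i<j (≢-sym i≢l)))
    ... | tri> _ _ j<i | tri> _ _ l<k =
      Q-swapˡ (Q-swap (Q-swapˡ (sort-minima l<k j<i (≢-sym j≢l))))

  -- Trichotomy

  module Trichotomy (indisc : Indiscernible) where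

    private
      Quad : Set
      Quad = ∃ λ i → ∃ λ j → ∃ λ k → ∃ λ l → i < j × j < k × k < l

      index : Quad → Fin 4 → I
      index (i , j , k , l , _) = i ∷ j ∷ k ∷ l ∷ []

      -- A pattern is given by positions in the quadruple, so that indiscernibility can move it to
      -- any other quadruple.
      Rel : (p q r s : Fin 4) → Quad → Set
      Rel p q r s ι = D (a (index ι p)) (a (index ι q)) (a (index ι r)) (a (index ι s))

      index-increasing : ∀ ι → Increasing (index ι)
      index-increasing (_ , _ , _ , _ , i<j , j<k , k<l) =
        increasing-∷ i<j (increasing-∷ j<k (increasing-∷ k<l increasing-[]))

      ≡-uniform : ∀ {i j i′ j′} → i < j → i′ < j′ → a i ≡ a j → a i′ ≡ a j′
      ≡-uniform i<j i′<j′ = proj₁ (indisc 2 (eqR zero (suc zero)) (_ ∷ _ ∷ []) (_ ∷ _ ∷ [])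
        (increasing-∷ i<j increasing-[]) (increasing-∷ i′<j′ increasing-[]))

      D-uniform : ∀ p q r s ι κ → Rel p q r s ι → Rel p q r s κ
      D-uniform p q r s ι κ = proj₁ (indisc 4 (dR p q r s) (index ι) (index κ)
        (index-increasing ι) (index-increasing κ))

      pattern 0F = zero
      pattern 1F = suc zero
      pattern 2F = suc (suc zero)
      pattern 3F = suc (suc (suc zero))

      -- On five indices 1 < … < 5, replacing 3 or 2 by 5 in 13|24 (D3) contradicts 14|25 or 14|35.
      not-crossing : ∀ ι → ¬ Rel 0F 2F 1F 3F ι
      not-crossing ι@(i , j , k , l , i<j , j<k , k<l) d
        with m , l<m ← upper l | move ← (λ κ → D-uniform 0F 2F 1F 3F ι κ d)
        with replace₂₃ d (a m)
      ... | inj₁ e = exclude e (swapʳ (move (i , j , l , m , i<j , <-trans j<k k<l , l<m)))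
      ... | inj₂ e = exclude e (move (i , k , l , m , <-trans i<j j<k , k<l , l<m))

      -- On five indices 1 < … < 5, replacing 1 or 2 by 5 in 14|23 (D3) contradicts 25|34 or 15|34.
      not-nested : ∀ ι → ¬ Rel 0F 3F 1F 2F ι
      not-nested ι@(i , j , k , l , i<j , j<k , k<l) d
        with m , l<m ← upper l | move ← (λ κ → D-uniform 0F 3F 1F 2F ι κ d)
        with replace₂₃ (swapˡ d) (a m)
      ... | inj₁ e = exclude e (swapʳ (swapˡ (swap (move (j , k , l , m , j<k , k<l , l<m)))))
      ... | inj₂ e = D2 (swapˡ e) (swapʳ (move (i , k , l , m , <-trans i<j j<k , k<l , l<m)))

      injective : (¬ ∃ λ i → ∃ λ j → i < j × a i ≡ a j) → Injective
      injective ¬eq i j e with compare i j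
      ... | tri< i<j _ _ = ⊥-elim (¬eq (i , j , i<j , e))
      ... | tri≈ _ i≡j _ = i≡j
      ... | tri> _ _ j<i = ⊥-elim (¬eq (j , i , j<i , sym e))

      constant : (∃ λ i → ∃ λ j → i < j × a i ≡ a j) → Constant
      constant (_ , _ , p<q , e) i j with compare i j
      ... | tri< i<j _ _ = ≡-uniform p<q i<j e
      ... | tri≈ _ i≡j _ = cong a i≡j
      ... | tri> _ _ j<i = sym (≡-uniform p<q j<i e)

      -- Two sorted pairs are sequential, crossing or nested; the hypothesis excludes the first, D3
      -- on five indices the other two.
      unrelated : (¬ ∃ λ ι → Rel 0F 1F 2F 3F ι) → ∀ {i j k l} → i < j → k < l → i < k →
                  ¬ D (a i) (a j) (a k) (a l)
      unrelated ¬seq {i} {j} {k} {l} i<j k<l i<k d with compare j k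
      ... | tri< j<k _ _ = ¬seq ((i , j , k , l , i<j , j<k , k<l) , d)
      ... | tri≈ _ refl _ = disjoint₂₃ d refl
      ... | tri> _ _ k<j with compare j l
      ...   | tri< j<l _ _ = not-crossing (i , k , j , l , i<k , k<j , j<l) d
      ...   | tri≈ _ refl _ = disjoint₂₄ d refl
      ...   | tri> _ _ l<j = not-nested (i , k , l , j , i<k , k<l , l<j) d

    trichotomy : Constant ⊎ Petaled ⊎ Monotonic
    trichotomy with em (∃ λ i → ∃ λ j → i < j × a i ≡ a j)
    ... | inj₁ eq = inj₁ (constant eq)
    ... | inj₂ ¬eq with em (∃ λ ι → Rel 0F 1F 2F 3F ι)
    ...   | inj₁ (ι , d) = inj₂ (inj₂ (injective ¬eq , λ i j k l i<j j<k k<l →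
              D-uniform 0F 1F 2F 3F ι (i , j , k , l , i<j , j<k , k<l) d))
    ...   | inj₂ ¬seq = inj₂ (inj₁ (injective ¬eq , λ i j k l →
              wlog-sorted (λ i j k l → ¬ D (a i) (a j) (a k) (a l)) (_∘ swapˡ) (_∘ swap)
                (unrelated ¬seq)))

  -- Transfer between index tuples of the same order type

  module _ {n} {ι κ : Fin n → I} (sot : SameOrderType ι κ) where

    -- `SameOrderType` speaks of `_<_` only; by trichotomy this also determines which indices
    -- coincide.
    ≢-transfer : ∀ p q → ι p ≢ ι q → κ p ≢ κ q
    ≢-transfer p q ιp≢ιq e with compare (ι p) (ι q)
    ... | tri< ιp<ιq _ _ = irrefl e (proj₁ (sot p q) ιp<ιq)
    ... | tri≈ _ ιp≡ιq _ = ιp≢ιq ιp≡ιq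
    ... | tri> _ _ ιq<ιp = irrefl (sym e) (proj₁ (sot q p) ιq<ιp)

    ≡-transfer : ∀ p q → ι p ≡ ι q → κ p ≡ κ q
    ≡-transfer p q e with compare (κ p) (κ q)
    ... | tri< κp<κq _ _ = ⊥-elim (irrefl e (proj₂ (sot p q) κp<κq))
    ... | tri≈ _ κp≡κq _ = κp≡κq
    ... | tri> _ _ κq<κp = ⊥-elim (irrefl (sym e) (proj₂ (sot q p) κq<κp))

    a-≢-transfer : Injective → ∀ p q → a (ι p) ≢ a (ι q) → a (κ p) ≢ a (κ q)
    a-≢-transfer inj p q ≢ = ≢-transfer p q (≢ ∘ cong a) ∘ inj _ _

  -- Coincidences among indices are decided by D2 and D4, so the hypotheses only concern distinct ones.
  module WeakIndiscernibility (B : Ω → Set) (inj : Injective) (B∩s : ∀ {x} → B x → ∀ i → x ≢ a i)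
    (transfer₀ : ∀ {n} {ι κ : Fin n → I} → SameOrderType ι κ → ∀ p q r s → ι p ≢ ι q → ι r ≢ ι s →
       D (a (ι p)) (a (ι q)) (a (ι r)) (a (ι s)) → D (a (κ p)) (a (κ q)) (a (κ r)) (a (κ s)))
    (transfer₁ : ∀ {n} {ι κ : Fin n → I} → SameOrderType ι κ → ∀ {x} → B x → ∀ p q r → ι q ≢ ι r →
       D x (a (ι p)) (a (ι q)) (a (ι r)) → D x (a (κ p)) (a (κ q)) (a (κ r)))
    (transfer₂ : ∀ {n} {ι κ : Fin n → I} → SameOrderType ι κ → ∀ {x y} → B x → B y → ∀ p q →
       ι p ≢ ι q → D x y (a (ι p)) (a (ι q)) → D x y (a (κ p)) (a (κ q)))
    (transfer₁₁ : ∀ {n} {ι κ : Fin n → I} → SameOrderType ι κ → ∀ {x y} → B x → B y → ∀ p q →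
       D x (a (ι p)) y (a (ι q)) → D x (a (κ p)) y (a (κ q)))
    (transfer₃ : ∀ {x y z} → B x → B y → B z → ∀ i j → D x y z (a i) → D x y z (a j))
    where

    private
      module _ {n} {ι κ : Fin n → I} (sot : SameOrderType ι κ) where

        move₀ : ∀ p q r s →
          D (a (ι p)) (a (ι q)) (a (ι r)) (a (ι s)) → D (a (κ p)) (a (κ q)) (a (κ r)) (a (κ s))
        move₀ p q r s d with dec-≡ (ι p) (ι q) | dec-≡ (ι r) (ι s)
        ... | inj₁ p≡q | _ = D-≡ˡ (cong a (≡-transfer sot p q p≡q))
                (a-≢-transfer sot inj p r (disjoint₁₃ d)) (a-≢-transfer sot inj p s (disjoint₁₄ d))
        ... | inj₂ _ | inj₁ r≡s = D-≡ʳ (cong a (≡-transfer sot r s r≡s))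
                (a-≢-transfer sot inj p r (disjoint₁₃ d)) (a-≢-transfer sot inj q r (disjoint₂₃ d))
        ... | inj₂ p≢q | inj₂ r≢s = transfer₀ sot p q r s p≢q r≢s d

        move₁ : ∀ {x} → B x → ∀ p q r →
          D x (a (ι p)) (a (ι q)) (a (ι r)) → D x (a (κ p)) (a (κ q)) (a (κ r))
        move₁ bx p q r d with dec-≡ (ι q) (ι r)
        ... | inj₁ q≡r = D-≡ʳ (cong a (≡-transfer sot q r q≡r)) (B∩s bx _)
                (a-≢-transfer sot inj p q (disjoint₂₃ d))
        ... | inj₂ q≢r = transfer₁ sot bx p q r q≢r d

        move₂ : ∀ {x y} → B x → B y → ∀ p q →
          D x y (a (ι p)) (a (ι q)) → D x y (a (κ p)) (a (κ q))
        move₂ bx by p q d with dec-≡ (ι p) (ι q)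
        ... | inj₁ p≡q = D-≡ʳ (cong a (≡-transfer sot p q p≡q)) (B∩s bx _) (B∩s by _)
        ... | inj₂ p≢q = transfer₂ sot bx by p q p≢q d

        -- By `D1` the distributions of variables and parameters reduce to five shapes, according to
        -- how many parameters stand on each side; with four parameters the indices do not occur.
        move : (t₁ t₂ t₃ t₄ : Term n B) →
          D (evalT ι t₁) (evalT ι t₂) (evalT ι t₃) (evalT ι t₄) →
          D (evalT κ t₁) (evalT κ t₂) (evalT κ t₃) (evalT κ t₄)
        move (inj₁ p) (inj₁ q) (inj₁ r) (inj₁ s) = move₀ p q r s
        move (inj₂ (_ , bx)) (inj₁ q) (inj₁ r) (inj₁ s) = move₁ bx q r s
        move (inj₁ p) (inj₂ (_ , bx)) (inj₁ r) (inj₁ s) = swapˡ ∘ move₁ bx p r s ∘ swapˡ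
        move (inj₁ p) (inj₁ q) (inj₂ (_ , bx)) (inj₁ s) = swap ∘ move₁ bx s p q ∘ swap
        move (inj₁ p) (inj₁ q) (inj₁ r) (inj₂ (_ , bx)) =
          swapʳ ∘ swap ∘ move₁ bx r p q ∘ swap ∘ swapʳ
        move (inj₂ (_ , bx)) (inj₂ (_ , by)) (inj₁ r) (inj₁ s) = move₂ bx by r s
        move (inj₁ p) (inj₁ q) (inj₂ (_ , bx)) (inj₂ (_ , by)) = swap ∘ move₂ bx by p q ∘ swap
        move (inj₂ (_ , bx)) (inj₁ q) (inj₂ (_ , by)) (inj₁ s) = transfer₁₁ sot bx by q s
        move (inj₂ (_ , bx)) (inj₁ q) (inj₁ r) (inj₂ (_ , by)) =
          swapʳ ∘ transfer₁₁ sot bx by q r ∘ swapʳ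
        move (inj₁ p) (inj₂ (_ , bx)) (inj₂ (_ , by)) (inj₁ s) =
          swapˡ ∘ transfer₁₁ sot bx by p s ∘ swapˡ
        move (inj₁ p) (inj₂ (_ , bx)) (inj₁ r) (inj₂ (_ , by)) =
          swapˡ ∘ swapʳ ∘ transfer₁₁ sot bx by p r ∘ swapʳ ∘ swapˡ
        move (inj₂ (_ , bx)) (inj₂ (_ , by)) (inj₂ (_ , bz)) (inj₁ s) = transfer₃ bx by bz _ _
        move (inj₂ (_ , bx)) (inj₂ (_ , by)) (inj₁ r) (inj₂ (_ , bz)) =
          swapʳ ∘ transfer₃ bx by bz _ _ ∘ swapʳ
        move (inj₂ (_ , bx)) (inj₁ q) (inj₂ (_ , by)) (inj₂ (_ , bz)) =
          swap ∘ transfer₃ by bz bx _ _ ∘ swap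
        move (inj₁ p) (inj₂ (_ , bx)) (inj₂ (_ , by)) (inj₂ (_ , bz)) =
          swapˡ ∘ swap ∘ transfer₃ by bz bx _ _ ∘ swap ∘ swapˡ
        move (inj₂ _) (inj₂ _) (inj₂ _) (inj₂ _) d = d

    weaklyIndiscernible : WeaklyIndiscernibleOver B
    weaklyIndiscernible n t₁ t₂ t₃ t₄ ι κ sot =
      move sot t₁ t₂ t₃ t₄ , move (λ k l → proj₂ (sot k l) , proj₁ (sot k l)) t₁ t₂ t₃ t₄

  -- Constant sequences

  constant⇒weaklyIndiscernible : Constant → ∀ B → WeaklyIndiscernibleOver B
  constant⇒weaklyIndiscernible const B n t₁ t₂ t₃ t₄ ι κ _ = move ι κ , move κ ι
    where
      eval-≡ : ∀ (ι κ : Fin n → I) (t : Term n B) → evalT ι t ≡ evalT κ t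
      eval-≡ ι κ (inj₁ k) = const (ι k) (κ k)
      eval-≡ ι κ (inj₂ _) = refl

      move : ∀ ι κ → D (evalT ι t₁) (evalT ι t₂) (evalT ι t₃) (evalT ι t₄) →
                     D (evalT κ t₁) (evalT κ t₂) (evalT κ t₃) (evalT κ t₄)
      move ι κ = D-resp-≡ (eval-≡ ι κ t₁) (eval-≡ ι κ t₂) (eval-≡ ι κ t₃) (eval-≡ ι κ t₄)

  -- Petaled sequences

  module PetaledSequence (petaled : Petaled) where

    private
      inj : Injective
      inj = proj₁ petaled

    a≢⇒≢ : ∀ {i j} → a i ≢ a j → i ≢ j
    a≢⇒≢ ai≢aj = ai≢aj ∘ cong a

    -- Indices on different sides of the bar are distinct because related points are, so
    -- distinctness within each pair suffices.
    no-petals : ∀ {i j k l} → i ≢ j → k ≢ l → ¬ D (a i) (a j) (a k) (a l)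
    no-petals i≢j k≢l d = proj₂ petaled _ _ _ _ i≢j (a≢⇒≢ (disjoint₁₃ d)) (a≢⇒≢ (disjoint₁₄ d))
      (a≢⇒≢ (disjoint₂₃ d)) (a≢⇒≢ (disjoint₂₄ d)) k≢l d

    _~_ : Ω → Ω → Set
    x ~ y = ∃ λ j → ∃ λ k → j ≢ k × D x y (a j) (a k)

    ~-sym : ∀ {x y} → x ~ y → y ~ x
    ~-sym (j , k , j≢k , d) = j , k , j≢k , swapˡ d

    -- If x ~ z fails, `D3` turns the witnesses into xy|z a_j, xy|z a_k, zy|x a_l and zy|x a_m.
    -- These give a_j a_k|x a_l and a_j a_k|x a_m, hence a_l a_m|a_j a_k, which a petaled sequence
    -- excludes.
    ~-trans : ∀ {x y z} → x ~ y → y ~ z → x ~ z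
    ~-trans {x} {y} {z} (j , k , j≢k , d) (l , m , l≢m , e) with em (x ~ z)
    ... | inj₁ x~z = x~z
    ... | inj₂ x≁z = ⊥-elim (no-petals l≢m j≢k
            (D-trans (swapˡ (swap (cross z|l))) (swap (cross z|m))))
      where
        x|j : D x y z (a j)
        x|j = drop-head (λ f → x≁z (k , j , ≢-sym j≢k , f)) (replace₂₃ (swapʳ d) z)
        x|k : D x y z (a k)
        x|k = drop-head (λ f → x≁z (j , k , j≢k , f)) (replace₂₃ d z)
        z|l : D z y x (a l)
        z|l = drop-head (λ f → x≁z (m , l , ≢-sym l≢m , swapˡ f)) (replace₂₃ (swapʳ (swapˡ e)) x)
        z|m : D z y x (a m)
        z|m = drop-head (λ f → x≁z (l , m , l≢m , swapˡ f)) (replace₂₃ (swapˡ e) x)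
        cross₁ : ∀ {p q} → D z y x (a p) → D x y z (a q) → D x (a p) z (a q)
        cross₁ z|p x|q = drop-last (λ f → D2 (swapˡ f) (swapˡ z|p)) (replace₂₄ x|q _)
        cross : ∀ {p} → D z y x (a p) → D (a j) (a k) x (a p)
        cross z|p = D-trans (swapˡ (swap (cross₁ z|p x|j))) (swap (cross₁ z|p x|k))

    -- Bringing `y` and then `z` into the witness gives the claim unless wz|y a_k and wz|y a_j both
    -- hold. As w ~ z fails, these would give w a_j|y a_k and w a_k|y a_j, two pairings of the same
    -- points.
    ~-split : ∀ {w x y z} → w ~ x → ¬ w ~ y → ¬ w ~ z → D w x y z
    ~-split {w} {x} {y} {z} (j , k , j≢k , d) w≁y w≁z
      with replace₂₄ (drop-head (λ f → w≁y (j , k , j≢k , f)) (replace₂₃ d y)) z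
         | replace₂₄ (drop-head (λ f → w≁y (k , j , ≢-sym j≢k , f)) (replace₂₃ (swapʳ d) y)) z
    ... | inj₂ e | _      = e
    ... | inj₁ _ | inj₂ e = e
    ... | inj₁ e | inj₁ f = ⊥-elim (exclude
            (drop-last (λ g → w≁z (j , k , j≢k , g)) (replace₂₃ e (a j)))
            (swapʳ (drop-last (λ g → w≁z (k , j , ≢-sym j≢k , g)) (replace₂₃ f (a k)))))

    ~⇒≡ : ∀ {i j} → a i ~ a j → i ≡ j
    ~⇒≡ {i} {j} (k , l , k≢l , d) with dec-≡ i j
    ... | inj₁ i≡j = i≡j
    ... | inj₂ i≢j = ⊥-elim (no-petals i≢j k≢l d)

    module _ (i : I) where

      private
        -- Three distinct indices: reflexivity needs two terms different from `x`, `~-separate` a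
        -- pigeonhole, and a node three sectors.
        j = proj₁ (upper i)
        k = proj₁ (upper j)
        i≢j : i ≢ j
        i≢j = <⇒≢ (proj₂ (upper i))
        j≢k : j ≢ k
        j≢k = <⇒≢ (proj₂ (upper j))
        i≢k : i ≢ k
        i≢k = <⇒≢ (<-trans (proj₂ (upper i)) (proj₂ (upper j)))

      ~-refl : ∀ {x} → x ~ x
      ~-refl {x} with em (x ≡ a i) | em (x ≡ a j)
      ... | inj₁ refl | _ = j , k , j≢k , D-≡ˡ refl (i≢j ∘ inj _ _) (i≢k ∘ inj _ _)
      ... | inj₂ _ | inj₁ refl = i , k , i≢k , D-≡ˡ refl (≢-sym i≢j ∘ inj _ _) (j≢k ∘ inj _ _)
      ... | inj₂ x≢i | inj₂ x≢j = i , j , i≢j , D-≡ˡ refl x≢i x≢j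

      -- Of three indices, two are on the same side of D(wx;yz).
      ~-separate : ∀ {w x y z} → ¬ w ~ x → ¬ y ~ z → ¬ D w x y z
      ~-separate {w} {x} {y} {z} w≁x y≁z d = pigeonhole (side i) (side j) (side k)
        where
          side : ∀ l → D w (a l) y z ⊎ D w x y (a l)
          side l = replace₂₄ d (a l)
          left : ∀ {l m} → l ≢ m → D w (a l) y z → ¬ D w (a m) y z
          left l≢m e f = y≁z (_ , _ , l≢m , swap (D-trans (swapˡ e) f))
          right : ∀ {l m} → l ≢ m → D w x y (a l) → ¬ D w x y (a m)
          right l≢m e f = w≁x (_ , _ , l≢m , swap (D-trans (swapˡ (swap e)) (swap f)))
          pigeonhole : D w (a i) y z ⊎ D w x y (a i) → D w (a j) y z ⊎ D w x y (a j) →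
                       ¬ (D w (a k) y z ⊎ D w x y (a k))
          pigeonhole (inj₁ e) (inj₁ f) _        = left i≢j e f
          pigeonhole (inj₁ e) (inj₂ f) (inj₁ g) = left i≢k e g
          pigeonhole (inj₁ e) (inj₂ f) (inj₂ g) = right j≢k f g
          pigeonhole (inj₂ e) (inj₁ f) (inj₁ g) = left j≢k f g
          pigeonhole (inj₂ e) (inj₁ f) (inj₂ g) = right i≢k e g
          pigeonhole (inj₂ e) (inj₂ f) _        = right i≢j e f

      ~-splitting : Splitting 𝔇
      ~-splitting = record
        { E = _~_
        ; E-refl = ~-refl
        ; E-sym = ~-sym
        ; E-trans = ~-trans
        ; two-parts = a i , a j , i≢j ∘ ~⇒≡
        ; split-i = ~-split
        ; split-ii = λ w≁x _ _ _ _ y≁z → ~-separate w≁x y≁z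
        }

      ~⇒InH : ∀ {x} → x ~ a i → InH x
      ~⇒InH x~ai = inj₁ (petaled , ~-splitting ,
        (a i , a j , a k , i≢j ∘ ~⇒≡ , i≢k ∘ ~⇒≡ , j≢k ∘ ~⇒≡) ,
        (λ l m → cong a ∘ ~⇒≡ , λ e → subst (a l ~_) e ~-refl) ,
        i , x~ai)

    module _ (B : Ω → Set) (B∩H : ∀ x → B x → ¬ InH x) where

      private
        B≁ : ∀ {x} → B x → ∀ i → ¬ x ~ a i
        B≁ bx i = B∩H _ bx ∘ ~⇒InH i

        separate : ∀ {x y i j} → B x → B y → ¬ D x (a i) y (a j)
        separate {i = i} {j} bx by = ~-separate i (B≁ bx i) (B≁ by j)

      -- For distinct `j` and `k`, x a_i|a_j a_k says x ~ a_i, so it fails, and x a_i|y a_j fails by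
      -- `~-separate`. For distinct indices xy|a_i a_j says x ~ y, which by `~-split` gives the
      -- relation at all indices. With three parameters `D3` changes the index, its other
      -- alternative being of the excluded mixed form.
      petaled⇒weaklyIndiscernible : WeaklyIndiscernibleOver B
      petaled⇒weaklyIndiscernible = WeakIndiscernibility.weaklyIndiscernible B inj
        (λ bx i e → B≁ bx i (subst (_~ a i) (sym e) (~-refl i)))
        (λ _ _ _ _ _ p≢q r≢s → ⊥-elim ∘ no-petals p≢q r≢s)
        (λ _ bx _ _ _ q≢r d → ⊥-elim (B≁ bx _ (_ , _ , q≢r , d)))
        (λ _ bx by _ _ p≢q d → ~-split (_ , _ , p≢q , d) (B≁ bx _) (B≁ bx _))
        (λ _ bx by _ _ → ⊥-elim ∘ separate bx by)
        (λ bx by bz i j d → drop-head (separate by bz ∘ swapˡ) (D3 d (a j)))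

  -- Monotonic sequences

  module MonotonicSequence (monotonic : Monotonic) where

    private
      inj : Injective
      inj = proj₁ monotonic

      <⇒a≢ : ∀ {i j} → i < j → a i ≢ a j
      <⇒a≢ i<j = <⇒≢ i<j ∘ inj _ _

    module Lower = LowerEnd 𝔇 isSTO lower a
    module Upper = LowerEnd 𝔇 (Flip.isStrictTotalOrder isSTO) upper a
    open Lower using (AtLowerEnd)
    open Upper using () renaming (AtLowerEnd to AtUpperEnd; below₂ to above₂)

    separated : ∀ {i j k l} → i < k → i < l → j < k → j < l → D (a i) (a j) (a k) (a l)
    separated {i} {j} {k} {l} i<k i<l j<k j<l with compare i j | compare k l
    ... | tri≈ _ refl _ | _             = D-≡ˡ refl (<⇒a≢ i<k) (<⇒a≢ i<l)
    ... | _             | tri≈ _ refl _ = D-≡ʳ refl (<⇒a≢ i<k) (<⇒a≢ j<k)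
    ... | tri< i<j _ _ | tri< k<l _ _ = proj₂ monotonic _ _ _ _ i<j j<k k<l
    ... | tri< i<j _ _ | tri> _ _ l<k = swapʳ (proj₂ monotonic _ _ _ _ i<j j<l l<k)
    ... | tri> _ _ j<i | tri< k<l _ _ = swapˡ (proj₂ monotonic _ _ _ _ j<i i<k k<l)
    ... | tri> _ _ j<i | tri> _ _ l<k = swapˡ (swapʳ (proj₂ monotonic _ _ _ _ j<i i<l l<k))

    Separated : I → I → I → I → Set
    Separated i j k l = (i < k × i < l × j < k × j < l) ⊎ (k < i × k < j × l < i × l < j)

    Separated⇒D : ∀ {i j k l} → Separated i j k l → D (a i) (a j) (a k) (a l)
    Separated⇒D (inj₁ (i<k , i<l , j<k , j<l)) = separated i<k i<l j<k j<l
    Separated⇒D (inj₂ (k<i , k<j , l<i , l<j)) = swap (separated k<i k<j l<i l<j)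

    -- After sorting, `i` is least. If `k` were below `j`, then a_i a_k|a_j a_l would hold, against
    -- `D2`.
    D⇒Separated : ∀ {i j k l} → i ≢ j → k ≢ l → D (a i) (a j) (a k) (a l) → Separated i j k l
    D⇒Separated i≢j k≢l d =
      wlog-sorted (λ i j k l → D (a i) (a j) (a k) (a l) → Separated i j k l)
        (λ f → flipˡ ∘ f ∘ swapˡ) (λ f → Sum.swap ∘ f ∘ swap) sorted
        i≢j (disjoint₁₃ d ∘ cong a) (disjoint₁₄ d ∘ cong a)
        (disjoint₂₃ d ∘ cong a) (disjoint₂₄ d ∘ cong a) k≢l d
      where
        flipˡ : ∀ {i j k l} → Separated i j k l → Separated j i k l
        flipˡ (inj₁ (p , q , r , s)) = inj₁ (r , s , p , q)
        flipˡ (inj₂ (p , q , r , s)) = inj₂ (q , p , s , r)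
        sorted : ∀ {i j k l} → i < j → k < l → i < k → D (a i) (a j) (a k) (a l) → Separated i j k l
        sorted {i} {j} {k} {l} i<j k<l i<k d with compare j k
        ... | tri< j<k _ _ = inj₁ (i<k , <-trans i<k k<l , j<k , <-trans j<k k<l)
        ... | tri≈ _ refl _ = ⊥-elim (disjoint₂₃ d refl)
        ... | tri> _ _ k<j = ⊥-elim (D2 d (separated i<j (<-trans i<k k<l) k<j k<l))

    -- `i` and `j` lie below `k` and `l`, so a_i a_j|a_k a_l holds instead. This discards
    -- alternatives of `D3` below.
    not-interlaced : ∀ {i j k l} → i < j → j < k → j < l → ¬ D (a l) (a i) (a j) (a k)
    not-interlaced i<j j<k j<l d =
      D2 (swapˡ d) (swapʳ (separated (<-trans i<j j<k) (<-trans i<j j<l) j<k j<l))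

    -- With `k` above `j`, `D3` brings `y` into x a_i|a_j a_k. It cannot replace `x`: being at the
    -- upper end, it is paired with a_k and not with a_i.
    opposite-ends : ∀ {x y i j} → AtLowerEnd x → AtUpperEnd y → i < j → D x (a i) y (a j)
    opposite-ends {y = y} {i} {j} x↓ y↑ i<j with upper j
    ... | k , j<k = swapʳ (drop-head (λ d → exclude d (y↑ k i j (<-trans i<j j<k) j<k))
                      (D3 (x↓ i j k i<j (<-trans i<j j<k)) y))

    module Outside {x} (x∉H : ¬ (InRange x ⊎ InH1 x ⊎ InH2 x ⊎ InH3 x)) where

      x∉s : ∀ i → x ≢ a i
      x∉s i e = x∉H (inj₁ (i , e))

      ¬H3 : ∀ {i j k l} → i < j → j < k → k < l →
            D (a i) x (a k) (a l) → ¬ D (a i) (a j) x (a l)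
      ¬H3 i<j j<k k<l d e = x∉H (inj₂ (inj₂ (inj₂ (_ , _ , _ , _ , i<j , j<k , k<l , d , e))))

      -- Outside H₂ some pairing of `x` with the three terms holds; outside H₁ it is not the one
      -- with the middle term.
      end-of-triple : ∀ {i j k} → i < j → j < k →
                      D x (a i) (a j) (a k) ⊎ D (a i) (a j) (a k) x
      end-of-triple {i} {j} {k} i<j j<k
        with em (D x (a i) (a j) (a k)) | em (D (a i) (a j) (a k) x)
      ... | inj₁ d | _      = inj₁ d
      ... | inj₂ _ | inj₁ d = inj₂ d
      ... | inj₂ ¬low | inj₂ ¬up = ⊥-elim (x∉H (inj₂ (inj₂ (inj₁ (i , j , k , i<j , j<k ,
              λ p q r t p∈ q∈ r∈ t∈ p≢q p≢r p≢t q≢r q≢t r≢t d →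
                none (distinct-in-quadruple p∈ q∈ r∈ t∈ p≢q p≢r p≢t q≢r q≢t r≢t d))))))
        where
          none : ¬ (D (a i) (a j) (a k) x ⊎ D (a i) (a k) (a j) x ⊎ D (a i) x (a j) (a k))
          none (inj₁ d)        = ¬up d
          none (inj₂ (inj₁ d)) = x∉H (inj₂ (inj₁ (i , j , k , i<j , j<k , d)))
          none (inj₂ (inj₂ d)) = ¬low (swapˡ d)

      -- Were `x` above the triple h, i, k, then a_h x|a_j a_k would follow by `D3`, and h, i, j, k
      -- would witness H₃.
      low-triple-descends : ∀ {h i j k} → h < i → i < j → j < k →
                            D x (a i) (a j) (a k) → D x (a h) (a i) (a k)
      low-triple-descends {h} h<i i<j j<k d with end-of-triple h<i (<-trans i<j j<k)
      ... | inj₁ e = e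
      ... | inj₂ e = ⊥-elim (¬H3 h<i i<j j<k
              (swapˡ (drop-last (λ f → D2 e (swapʳ (swap f))) (replace₂₃ d (a h)))) (swapʳ e))

      -- With `h` fixed, one index moves at a time: `k` up to a common upper bound `l` of `i` and
      -- `q`, then `i` to `p`, then `l` down to `q`.
      low-triple-spreads : ∀ {h i k p q} → h < i → i < k → h < p → p < q →
                           D x (a h) (a i) (a k) → D x (a h) (a p) (a q)
      low-triple-spreads {h} {i} {k} {p} {q} h<i i<k h<p p<q d =
        drop-head (not-interlaced h<p p<l p<q) (D3 at-p (a q))
        where
          l = proj₁ (above₂ i q)
          i<l : i < l
          i<l = proj₁ (proj₂ (above₂ i q))
          p<l : p < l
          p<l = <-trans p<q (proj₂ (proj₂ (above₂ i q)))
          at-i : D x (a h) (a i) (a l)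
          at-i = drop-head (not-interlaced h<i i<k i<l) (D3 d (a l))
          at-p : D x (a h) (a p) (a l)
          at-p with compare p i
          ... | tri≈ _ refl _ = at-i
          ... | tri> _ _ i<p =
            swapʳ (drop-head (not-interlaced h<i i<l i<p ∘ swapʳ) (D3 (swapʳ at-i) (a p)))
          -- Moving down from `i` uses H₃: if `x` were above h, p, l, then h, p, i, l would be a
          -- witness.
          ... | tri< p<i _ _ with end-of-triple h<p p<l
          ...   | inj₁ e = e
          ...   | inj₂ e = ⊥-elim (¬H3 h<p p<i i<l (swapˡ at-i) (swapʳ e))

      -- The triple is moved down to some `h` below `m` and `i` and spread to p, q; since a_h
      -- a_m|a_p a_q, transitivity replaces a_h by a_m.
      low-triple⇒AtLowerEnd : ∀ {i j k} → i < j → j < k → D x (a i) (a j) (a k) → AtLowerEnd x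
      low-triple⇒AtLowerEnd {i} i<j j<k d = Lower.AtLowerEnd-sorted x∉s <⇒a≢ sorted
        where
          sorted : ∀ {m p q} → m < p → p < q → D x (a m) (a p) (a q)
          sorted {m} m<p p<q with Lower.below₂ m i
          ... | h , h<m , h<i = D-trans
            (low-triple-spreads h<i (<-trans i<j j<k) (<-trans h<m m<p) p<q
              (low-triple-descends h<i i<j j<k d))
            (separated (<-trans h<m m<p) (<-trans h<m (<-trans m<p p<q)) m<p (<-trans m<p p<q))

      -- One low triple puts `x` at the lower end; if there is none, every triple has `x` at its
      -- upper side.
      at-end : AtLowerEnd x ⊎ AtUpperEnd x
      at-end with em (∃ λ i → ∃ λ j → ∃ λ k → i < j × j < k × D x (a i) (a j) (a k))
      ... | inj₁ (_ , _ , _ , i<j , j<k , d) = inj₁ (low-triple⇒AtLowerEnd i<j j<k d)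
      ... | inj₂ ¬low = inj₂ (Upper.AtLowerEnd-sorted x∉s (≢-sym ∘ <⇒a≢) λ j<i k<j →
              swapʳ (swapˡ (swap (drop-head (λ d → ¬low (_ , _ , _ , k<j , j<i , d))
                (end-of-triple k<j j<i)))))

    module _ (B : Ω → Set) (B∩H : ∀ x → B x → ¬ InH x) where

      private
        module _ {x} (bx : B x) where
          open Outside {x} (λ x∈ → B∩H x bx (inj₂ (lift (monotonic , x∈)))) public
            using (x∉s; at-end)

        transfer₁ : ∀ {x i j k i′ j′ k′} → B x → (i < j → i′ < j′) → (i < k → i′ < k′) →
          (j < i → j′ < i′) → (k < i → k′ < i′) → j ≢ k →
          D x (a i) (a j) (a k) → D x (a i′) (a j′) (a k′)
        transfer₁ bx i<j i<k j<i k<i with at-end bx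
        ... | inj₁ x↓ = Lower.end-transfer x↓ i<j i<k
        ... | inj₂ x↑ = Upper.end-transfer x↑ j<i k<i

        opposite-ends-unrelated : ∀ {x y i j} → AtLowerEnd x → AtUpperEnd y → i ≢ j →
                                  ¬ D x y (a i) (a j)
        opposite-ends-unrelated {i = i} {j} x↓ y↑ i≢j d with compare i j
        ... | tri< i<j _ _ = D2 d (opposite-ends x↓ y↑ i<j)
        ... | tri≈ _ i≡j _ = i≢j i≡j
        ... | tri> _ _ j<i = exclude d (opposite-ends x↓ y↑ j<i)

        transfer₂ : ∀ {x y i j} i′ j′ → B x → B y → i ≢ j →
          D x y (a i) (a j) → D x y (a i′) (a j′)
        transfer₂ i′ j′ bx by i≢j d with at-end bx | at-end by
        ... | inj₁ x↓ | inj₁ y↓ = Lower.same-end x↓ y↓ i′ j′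
        ... | inj₂ x↑ | inj₂ y↑ = Upper.same-end x↑ y↑ i′ j′
        ... | inj₁ x↓ | inj₂ y↑ = ⊥-elim (opposite-ends-unrelated x↓ y↑ i≢j d)
        ... | inj₂ x↑ | inj₁ y↓ = ⊥-elim (opposite-ends-unrelated y↓ x↑ i≢j (swapˡ d))

        opposite-transfer : ∀ {x y i j i′ j′} → AtLowerEnd x → AtUpperEnd y → (i < j → i′ < j′) →
          D x (a i) y (a j) → D x (a i′) y (a j′)
        opposite-transfer {i = i} {j} x↓ y↑ f d with compare i j
        ... | tri< i<j _ _ = opposite-ends x↓ y↑ (f i<j)
        ... | tri≈ _ refl _ = ⊥-elim (disjoint₂₄ d refl)
        ... | tri> _ _ j<i = ⊥-elim (exclude d (swapʳ (opposite-ends x↓ y↑ j<i)))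

        transfer₁₁ : ∀ {x y i j i′ j′} → B x → B y → (i < j → i′ < j′) → (j < i → j′ < i′) →
          D x (a i) y (a j) → D x (a i′) y (a j′)
        transfer₁₁ {i = i} {j} bx by i<j j<i d with at-end bx | at-end by
        ... | inj₁ x↓ | inj₁ y↓ = ⊥-elim (D2 d (Lower.same-end x↓ y↓ i j))
        ... | inj₂ x↑ | inj₂ y↑ = ⊥-elim (D2 d (Upper.same-end x↑ y↑ i j))
        ... | inj₁ x↓ | inj₂ y↑ = opposite-transfer x↓ y↑ i<j d
        ... | inj₂ x↑ | inj₁ y↓ = swap (opposite-transfer y↓ x↑ j<i (swap d))

        -- If replacing a_i by a_j fails, then z is at the other end than x and y.
        transfer₃ : ∀ {x y z} → B x → B y → B z → ∀ i j → D x y z (a i) → D x y z (a j)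
        transfer₃ bx by bz i j d with D3 d (a j) | D3 (swapˡ d) (a j)
        ... | inj₂ e | _      = e
        ... | inj₁ _ | inj₂ e = swapˡ e
        ... | inj₁ e | inj₁ f with compare i j
        ...   | tri≈ _ refl _ = d
        -- x a_j|z a_i and y a_j|z a_i depend only on the order of the indices, so they also hold
        -- for k, j in place of j, i; transitivity then eliminates a_k.
        ...   | tri< i<j _ _ = let k , j<k = upper j in
                D-trans (transfer₁₁ bx bz (⊥-elim ∘ asym i<j) (λ _ → j<k) (swapˡ f))
                  (swapˡ (transfer₁₁ by bz (⊥-elim ∘ asym i<j) (λ _ → j<k) (swapˡ e)))
        ...   | tri> _ _ j<i = let k , k<j = lower j in
                D-trans (transfer₁₁ bx bz (λ _ → k<j) (⊥-elim ∘ asym j<i) (swapˡ f))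
                  (swapˡ (transfer₁₁ by bz (λ _ → k<j) (⊥-elim ∘ asym j<i) (swapˡ e)))

        Separated-transfer : ∀ {n} {ι κ : Fin n → I} → SameOrderType ι κ → ∀ p q r s →
          Separated (ι p) (ι q) (ι r) (ι s) → Separated (κ p) (κ q) (κ r) (κ s)
        Separated-transfer sot p q r s (inj₁ (pr , ps , qr , qs)) = inj₁
          (proj₁ (sot p r) pr , proj₁ (sot p s) ps , proj₁ (sot q r) qr , proj₁ (sot q s) qs)
        Separated-transfer sot p q r s (inj₂ (rp , rq , sp , sq)) = inj₂
          (proj₁ (sot r p) rp , proj₁ (sot r q) rq , proj₁ (sot s p) sp , proj₁ (sot s q) sq)

      monotonic⇒weaklyIndiscernible : WeaklyIndiscernibleOver B
      monotonic⇒weaklyIndiscernible = WeakIndiscernibility.weaklyIndiscernible B inj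
        x∉s
        (λ sot p q r s p≢q r≢s → Separated⇒D ∘ Separated-transfer sot p q r s ∘ D⇒Separated p≢q r≢s)
        (λ sot bx p q r → transfer₁ bx (proj₁ (sot p q)) (proj₁ (sot p r))
                                       (proj₁ (sot q p)) (proj₁ (sot r p)))
        (λ _ bx by _ _ → transfer₂ _ _ bx by)
        (λ sot bx by p q → transfer₁₁ bx by (proj₁ (sot p q)) (proj₁ (sot q p)))
        transfer₃

  -- Members of the hull break weak indiscernibility

  module HullDiscerns {B : Ω → Set} (wi : WeaklyIndiscernibleOver B) {x : Ω} (bx : B x) where

    private
      𝐱 : ∀ {n} → Term n B
      𝐱 = inj₂ (x , bx)

      Triple : Set
      Triple = ∃ λ i → ∃ λ j → ∃ λ k → i < j × j < k

      index : Triple → Fin 3 → I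
      index (i , j , k , _) = i ∷ j ∷ k ∷ []

      Rel : (t₁ t₂ t₃ t₄ : Term 3 B) → Triple → Set
      Rel t₁ t₂ t₃ t₄ ι = D (eval t₁) (eval t₂) (eval t₃) (eval t₄)
        where
          eval : Term 3 B → Ω
          eval = evalT (index ι)

      index-increasing : ∀ ι → Increasing (index ι)
      index-increasing (_ , _ , _ , i<j , j<k) = increasing-∷ i<j (increasing-∷ j<k increasing-[])

      uniform : ∀ t₁ t₂ t₃ t₄ ι κ → Rel t₁ t₂ t₃ t₄ ι → Rel t₁ t₂ t₃ t₄ κ
      uniform t₁ t₂ t₃ t₄ ι κ = proj₁ (wi 3 t₁ t₂ t₃ t₄ (index ι) (index κ)
        (sameOrderType (index-increasing ι) (index-increasing κ)))

      pattern 0F = inj₁ zero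
      pattern 1F = inj₁ (suc zero)
      pattern 2F = inj₁ (suc (suc zero))

    -- xx|a_j a_j holds by `D4`; moved to the index of `x` it would relate `x` to itself.
    ∉range : Injective → ¬ InRange x
    ∉range inj (i , refl) with upper i
    ... | j , i<j = disjoint₁₃ (proj₁ (wi 1 𝐱 𝐱 0F 0F (j ∷ []) (i ∷ []) sot) (D4 ≢j ≢j)) refl
      where
        ≢j : a i ≢ a j
        ≢j = <⇒≢ i<j ∘ inj _ _
        sot : SameOrderType (j ∷ []) (i ∷ [])
        sot = sameOrderType increasing-[] increasing-[]

    -- The sector of a_i gives x a_i|a_j a_k with `i` as least index. Moved to h, i, j it reads x
    -- a_h|a_i a_j, but the sector also gives x a_i|a_h a_j.
    ∉petal : Petaled → ¬ InHPetal x
    ∉petal (inj , _) (S , _ , singletons , i , x~ai) with upper i | lower i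
    ... | j , i<j | h , h<i with upper j
    ...   | k , j<k = D2
            (uniform 𝐱 0F 1F 2F (i , j , k , i<j , j<k) (h , i , j , h<i , i<j)
              (split (<⇒≢ i<j) (<⇒≢ (<-trans i<j j<k))))
            (split (≢-sym (<⇒≢ h<i)) (<⇒≢ i<j))
      where
        open Splitting S
        split : ∀ {l m} → i ≢ l → i ≢ m → D x (a i) (a l) (a m)
        split i≢l i≢m = split-i x~ai (apart i≢l) (apart i≢m)
          where
            apart : ∀ {l} → i ≢ l → ¬ E x (a l)
            apart i≢l x~al = i≢l (inj _ _ (proj₁ (singletons _ _) (E-trans (E-sym x~ai) x~al)))

    module _ (monotonic : Monotonic) where
      private
        mono = proj₂ monotonic

        x≢a : ∀ {i} → x ≢ a i
        x≢a e = ∉range (proj₁ monotonic) (_ , e)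

        <⇒a≢ : ∀ {i j} → i < j → a i ≢ a j
        <⇒a≢ i<j = <⇒≢ i<j ∘ proj₁ monotonic _ _

      -- Moved to j, k, l the relation reads a_j a_l|a_k x. Bringing in a_i leaves a_j a_i|a_k x, as
      -- monotonicity excludes a_j a_l|a_k a_i; this contradicts the relation on i, j, k.
      ∉H1 : ¬ InH1 x
      ∉H1 (i , j , k , i<j , j<k , d) with upper k
      ... | l , k<l = D2 d (swapˡ (drop-last
            (λ e → D2 (mono i j k l i<j j<k k<l) (swapˡ (swap e)))
            (replace₂₄ (uniform 0F 2F 1F 𝐱 (i , j , k , i<j , j<k) (j , k , l , j<k , k<l) d) (a i))))

      -- Bringing `x` into a_i a_j|a_k a_l relates it to three terms; if these are j, k, l, the
      -- relation is moved to i, j, k.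
      ∉H2 : ¬ InH2 x
      ∉H2 (i , j , k , i<j , j<k , none) with upper k
      ... | l , k<l with D3 (mono i j k l i<j j<k k<l) x
      ...   | inj₁ d = none _ _ _ _ (inj₂ (inj₂ (inj₂ refl))) (inj₁ refl) (inj₂ (inj₁ refl))
                (inj₂ (inj₂ (inj₁ refl))) x≢a x≢a x≢a (<⇒a≢ i<j) (<⇒a≢ (<-trans i<j j<k)) (<⇒a≢ j<k)
                (uniform 𝐱 0F 1F 2F (j , k , l , j<k , k<l) (i , j , k , i<j , j<k) d)
      ...   | inj₂ d = none _ _ _ _ (inj₁ refl) (inj₂ (inj₁ refl)) (inj₂ (inj₂ (inj₁ refl)))
                (inj₂ (inj₂ (inj₂ refl))) (<⇒a≢ i<j) (<⇒a≢ (<-trans i<j j<k)) (≢-sym x≢a)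
                (<⇒a≢ j<k) (≢-sym x≢a) (≢-sym x≢a) d

      -- Moving a_i x|a_k a_l to the indices i, j, l gives a_i x|a_j a_l, against a_i a_j|x a_l.
      ∉H3 : ¬ InH3 x
      ∉H3 (i , j , k , l , i<j , j<k , k<l , d , e) = D2
        (uniform 0F 𝐱 1F 2F (i , k , l , <-trans i<j j<k , k<l) (i , j , l , i<j , <-trans j<k k<l) d)
        e

    ∉H : ¬ InH x
    ∉H (inj₁ (petaled , x∈))                             = ∉petal petaled x∈
    ∉H (inj₂ (lift (monotonic , inj₁ x∈)))               = ∉range (proj₁ monotonic) x∈
    ∉H (inj₂ (lift (monotonic , inj₂ (inj₁ x∈))))        = ∉H1 monotonic x∈
    ∉H (inj₂ (lift (monotonic , inj₂ (inj₂ (inj₁ x∈))))) = ∉H2 monotonic x∈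
    ∉H (inj₂ (lift (monotonic , inj₂ (inj₂ (inj₂ x∈))))) = ∉H3 monotonic x∈

  -- Assembly of the two directions

  outside-hull⇒weaklyIndiscernible : Indiscernible → ∀ B → (∀ x → B x → ¬ InH x) →
                                     WeaklyIndiscernibleOver B
  outside-hull⇒weaklyIndiscernible indisc B B∩H with Trichotomy.trichotomy indisc
  ... | inj₁ constant         = constant⇒weaklyIndiscernible constant B
  ... | inj₂ (inj₁ petaled)   = PetaledSequence.petaled⇒weaklyIndiscernible petaled B B∩H
  ... | inj₂ (inj₂ monotonic) = MonotonicSequence.monotonic⇒weaklyIndiscernible monotonic B B∩H

mainTheorem16 : ExcludedMiddle → (𝔇 : DSet) → (U : Set) → (P : U → DSet.Ω 𝔇 → Set) →
    (L : LinOrd) → Unbounded L → (a : LinOrd.I L → DSet.Ω 𝔇) →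
    Lang.Seq.Indiscernible 𝔇 U P L a →
    (B : DSet.Ω 𝔇 → Set) →
    Lang.Seq.WeaklyIndiscernibleOver 𝔇 U P L a B
    ⇔ (∀ x → B x → ¬ Lang.Seq.InH 𝔇 U P L a x)
mainTheorem16 em 𝔇 U P L unbounded a indisc B =
  (λ wi x bx → HullDiscerns.∉H em 𝔇 U P L unbounded a wi bx) ,
  outside-hull⇒weaklyIndiscernible em 𝔇 U P L unbounded a indisc B
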